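{- Let $A$, $B$, $C$ be well-founded binary relations on a set $V$. Suppose that $$(B\cup C)\,A \;\subseteq\; A\,(A\cup B\cup C)^* \,\cup\, B \,\cup\, C$$ and $$C\,B \;\subseteq\; A\,(A\cup B\cup C)^* \,\cup\, B\,B^* \,\cup\, C .$$ Then the union $A\cup B\cup C$ is well-founded.
   Context: A binary relation $R$ on $V$ is called well-founded if there is no infinite forward-pointing path, i.e. no infinite sequence $x_0,x_1,x_2,\dots$ of (not necessarily distinct) elements of $V$ with $x_i \mathrel{R} x_{i+1}$ for all $i\ge 0$. Juxtaposition denotes composition of relations read from left to right: $x \mathrel{(RS)} z$ iff there is $y\in V$ with $x\mathrel{R}y$ and $y\mathrel{S}z$. $R^*$ denotes the reflexive-transitive closure of $R$ (zero or more $R$-steps), so that $BB^*$ means one or more $B$-steps. Composition binds more tightly than union. -}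

module Defs where

open import Data.Nat.Base using (ℕ; suc)
open import Data.Product.Base using (Σ-syntax)
open import Level using (Level; _⊔_)
open import Relation.Binary.Core using (Rel)
open import Relation.Nullary.Negation.Core using (¬_)

private
  variable
    a ℓ : Level

-- Not the accessibility-based WellFounded of Induction.WellFounded, which
-- forbids descending rather than forward-pointing chains and is constructively
-- stronger than the absence of infinite chains.  Reasoning with this weaker
-- notion is where excluded middle is needed as an explicit hypothesis.
ForwardWellFounded : {V : Set a} → Rel V ℓ → Set (a ⊔ ℓ)
ForwardWellFounded {V = V} R =
  ¬ (Σ[ x ∈ (ℕ → V) ] ∀ i → R (x i) (x (suc i)))

{-# OPTIONS --safe #-}

-- Call a point immortal if it reaches a given infinite path.  Let M be the
-- immortal points without an immortal A-successor, and N the points of M from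
-- which no point of M is reached by one or more B-steps.  Well-foundedness of A
-- and B makes N nonempty.  The inclusions, whose alternatives beginning with an
-- A-step are impossible from M, allow a step out of M or N to be followed by the
-- descent back into M or N without ceasing to be a single step.  So each point
-- of N has a C-successor in N, contradicting the well-foundedness of C.
module Submission where

open import Defs
open import Axiom.ExcludedMiddle using (ExcludedMiddle)
open import Level using (Level; _⊔_)
open import Relation.Binary.Core using (Rel; _⇒_)
open import Relation.Binary.Construct.Closure.ReflexiveTransitive
  using (Star; ε; _◅_; _◅◅_; map)
open import Relation.Binary.Construct.Composition using (_;_)
open import Relation.Binary.Construct.Union using (_∪_)
open import Data.Empty using (⊥-elim)
open import Data.Nat.Base using (ℕ; zero; suc)
open import Data.Product.Base using (Σ; ∃-syntax; _×_; _,_; proj₁; proj₂)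
open import Data.Sum.Base using (inj₁; inj₂)
open import Relation.Nullary.Decidable.Core using (yes; no)
open import Relation.Nullary.Negation.Core using (¬_)
open import Relation.Unary using (Pred)

private
  variable
    a ℓ p : Level
    V : Set a

Terminal : Rel V ℓ → Pred V p → Pred V _
Terminal R P x = P x × (∀ {y} → R x y → ¬ P y)

ReachesVia : Rel V ℓ → Pred V p → Pred V _
ReachesVia R P x = ∃[ y ] (Star R x y × P y)

-- The witness in `next` is already a choice function, so iterating it yields an infinite path
-- without an axiom of choice.
serial⇒empty : {R : Rel V ℓ} {P : Pred V p} → ForwardWellFounded R →
               (∀ {x} → P x → ∃[ y ] (R x y × P y)) → ∀ {x} → ¬ P x
serial⇒empty {V = V} {R = R} {P = P} wf next {x} px =
  wf ((λ i → proj₁ (path i)) , λ i → proj₁ (proj₂ (next (proj₂ (path i)))))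
  where
  path : ℕ → Σ V P
  path zero    = x , px
  path (suc i) = let y , _ , py = next (proj₂ (path i)) in y , py

module _ (em : ExcludedMiddle (a ⊔ ℓ)) {V : Set a} where

  -- Otherwise no point of `P` reached from `x` is terminal, so each has a successor of the same
  -- kind, and `serial⇒empty` applies.
  reachesTerminal : {R : Rel V ℓ} → ForwardWellFounded R →
                    (P : Pred V (a ⊔ ℓ)) → ∀ {x} → P x → ReachesVia R (Terminal R P) x
  reachesTerminal {R} wf P {x} px with em {ReachesVia R (Terminal R P) x}
  ... | yes found = found
  ... | no ¬found = ⊥-elim (serial⇒empty wf next (ε , px))
    where
    next : ∀ {y} → Star R x y × P y → ∃[ z ] (R y z × Star R x z × P z)
    next {y} (xy , py) with em {∃[ z ] (R y z × P z)}
    ... | yes (z , yz , pz) = z , yz , (xy ◅◅ (yz ◅ ε)) , pz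
    ... | no ¬next = ⊥-elim (¬found (y , xy , py , λ yz pz → ¬next (_ , yz , pz)))

  module _ (A B C : Rel V ℓ)
    (wfA : ForwardWellFounded A) (wfB : ForwardWellFounded B) (wfC : ForwardWellFounded C)
    (BCA⇒ : ((B ∪ C) ; A) ⇒ ((A ; Star (A ∪ B ∪ C)) ∪ B ∪ C))
    (CB⇒ : (C ; B) ⇒ ((A ; Star (A ∪ B ∪ C)) ∪ (B ; Star B) ∪ C))
    where

    private
      U : Rel V ℓ
      U = A ∪ B ∪ C

      A⇒U : A ⇒ U
      A⇒U = inj₁

      B⇒U : B ⇒ U
      B⇒U r = inj₂ (inj₁ r)

    module _ (f : ℕ → V) (f-path : ∀ i → U (f i) (f (suc i))) where

      Immortal : Pred V (a ⊔ ℓ)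
      Immortal x = ∃[ i ] Star U x (f i)

      immortal-◅◅ : ∀ {x y} → Star U x y → Immortal y → Immortal x
      immortal-◅◅ xy (i , yf) = i , xy ◅◅ yf

      immortal-step : ∀ {x} → Immortal x → ∃[ y ] (U x y × Immortal y)
      immortal-step (i , ε)      = f (suc i) , f-path i , suc i , ε
      immortal-step (i , r ◅ rs) = _ , r , i , rs

      M : Pred V (a ⊔ ℓ)
      M = Terminal A Immortal

      ReachesM : Pred V (a ⊔ ℓ)
      ReachesM = ReachesVia B M

      N : Pred V (a ⊔ ℓ)
      N x = M x × (∀ {y} → B x y → ¬ ReachesM y)

      -- The A-steps are absorbed one at a time, always from `x`, so the points in between need not
      -- lie in `M`. An alternative starting with an A-step from `x` would lead on to `z`, making an
      -- A-successor of `x` immortal.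
      absorb-A* : ∀ {x y z} → M x → (B ∪ C) x y → Star A y z → Immortal z → (B ∪ C) x z
      absorb-A* mx r ε iz = r
      absorb-A* mx r (s ◅ ss) iz with BCA⇒ (_ , r , s)
      ... | inj₁ (w , xw , wy) =
        ⊥-elim (proj₂ mx xw (immortal-◅◅ (wy ◅◅ map A⇒U ss) iz))
      ... | inj₂ r′ = absorb-A* mx r′ ss iz

      absorb-B* : ∀ {x y z} → N x → C x y → Star B y z → M z → C x z
      absorb-B* nx r ε mz = r
      absorb-B* nx@((_ , noA) , noB) r (s ◅ ss) mz with CB⇒ (_ , r , s)
      ... | inj₁ (w , xw , wy) =
        ⊥-elim (noA xw (immortal-◅◅ (wy ◅◅ map B⇒U ss) (proj₁ mz)))
      -- The B-path from `x` continues along `ss` to `z` in `M`, which `N` forbids.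
      ... | inj₂ (inj₁ (w , xw , wy)) = ⊥-elim (noB xw (_ , wy ◅◅ ss , mz))
      ... | inj₂ (inj₂ r′) = absorb-B* nx r′ ss mz

      M-step : ∀ {x} → M x → ∃[ y ] ((B ∪ C) x y × M y)
      M-step mx@(ix , noA) with immortal-step ix
      ... | y , inj₁ r , iy = ⊥-elim (noA r iy)
      ... | y , inj₂ r , iy =
        let z , yz , mz = reachesTerminal wfA Immortal iy
        in z , absorb-A* mx r yz (proj₁ mz) , mz

      -- A B-path into `M` may leave `M` on the way, so the terminal point is sought in `ReachesM`.
      -- It lies in `M` itself: a nonempty B-path from it to `M` would put its first successor in
      -- `ReachesM`.
      reachesN : ∀ {x} → M x → ReachesVia B N x
      reachesN mx with reachesTerminal wfB ReachesM (_ , ε , mx)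
      ... | y , xy , (.y , ε      , my) , noB = y , xy , my , noB
      ... | y , xy , (z  , r ◅ rs , mz) , noB = ⊥-elim (noB r (z , rs , mz))

      N-step : ∀ {x} → N x → ∃[ y ] (C x y × N y)
      N-step nx@(mx , noB) with M-step mx
      ... | y , inj₁ r , my = ⊥-elim (noB r (y , ε , my))
      ... | y , inj₂ r , my =
        let z , yz , nz = reachesN my
        in z , absorb-B* nx r yz (proj₁ nz) , nz

      N-nonempty : ∃[ x ] N x
      N-nonempty =
        -- The descent starts at `f 0`, immortal by the empty path.
        let _ , _ , my = reachesTerminal {A} wfA Immortal (0 , ε)
            z , _ , nz = reachesN my
        in z , nz

    union-wellFounded : ForwardWellFounded (A ∪ B ∪ C)
    union-wellFounded (f , f-path) =
      serial⇒empty wfC (N-step f f-path) (proj₂ (N-nonempty f f-path))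

theorem3 : ∀ {a ℓ} → ExcludedMiddle (a ⊔ ℓ) →
    {V : Set a} (A B C : Rel V ℓ) →
    ForwardWellFounded A → ForwardWellFounded B → ForwardWellFounded C →
    ((B ∪ C) ; A) ⇒ ((A ; Star (A ∪ B ∪ C)) ∪ B ∪ C) →
    (C ; B) ⇒ ((A ; Star (A ∪ B ∪ C)) ∪ (B ; Star B) ∪ C) →
    ForwardWellFounded (A ∪ B ∪ C)
theorem3 em = union-wellFounded em
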